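{- Let $H$ be an ordered graph on $h$ vertices. For every $n\in\mathbb N$ with $h\mid n$, there is an $n$-vertex ordered graph $G$ with $\delta(G)\ge\lfloor(1-\alpha^*(H))n\rfloor-1$ that does not contain a perfect $H$-tiling.
   Context: An ordered graph $H$ on $h$ vertices is a graph whose vertices have been labelled with $[h]=\{1,\dots,h\}$. An ordered graph $G$ with vertex set $[n]$ contains $H$ if there is a map $\phi:[h]\to[n]$ with $\phi(i)<\phi(j)$ for all $1\le i<j\le h$ and with $\phi(i)\phi(j)\in E(G)$ whenever $ij\in E(H)$. An $H$-tiling in $G$ is a collection of vertex-disjoint copies of $H$ contained in $G$; it is perfect if it covers all the vertices of $G$. $\delta(G)$ denotes the minimum degree of $G$. The interval chromatic number $\chi_{<}(H)$ is the minimum number of intervals into which $[h]$ can be partitioned so that no two vertices belonging to the same interval are adjacent in $H$. Let $\alpha_0^+(H):=0$ and for $1\le \ell\le\chi_{<}(H)$ let $\alpha_\ell^+(H)$ be the largest $k\in\mathbb N$ (with $k\le h$) such that $[\alpha_{\ell-1}^+(H)+1,k]$ is an independent set in $H$. Let $\alpha_0^-(H):=h+1$ and for $1\le\ell\le\chi_{<}(H)$ let $\alpha_\ell^-(H)$ be the smallest $k\in\mathbb N$ (with $k\ge 1$) such that $[k,\alpha_{\ell-1}^-(H)-1]$ is an independent set in $H$. Define $$\alpha^*(H):=\min_{1\le \ell<\chi_{<}(H)}\min\left\{\frac{\alpha_\ell^+(H)}{\ell\cdot h},\ \frac{h-\alpha_\ell^-(H)+1}{\ell\cdot h}\right\}.$$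 -}

module Defs where

open import Data.Fin.Base as Fin using (Fin; toℕ; finToFun; funToFin)
import Data.Fin.Properties as Fin
open import Data.Integer.Base using (+_)
open import Data.List.Base using (List; map; filter; length; upTo; allFin)
open import Data.List.Extrema.Nat using (min; max)
import Data.List.Extrema
open import Data.Nat.Base using (ℕ; zero; suc; _*_; _∸_; _≤_; NonZero)
open import Data.Nat.Properties using (_≤?_; m*n≢0)
open import Data.Product.Base using (∃; ∃₂; _×_; _,_)
open import Data.Rational.Base as ℚ using (ℚ)
import Data.Rational.Properties as ℚ
open import Function.Definitions using (StrictlySurjective)
open import Level using (0ℓ)
open import Relation.Binary.Bundles using (DecTotalOrder)
open import Relation.Binary.Core using (Rel)
open import Relation.Binary.Definitions using (Symmetric; Irreflexive; Decidable)
open import Relation.Binary.PropositionalEquality using (_≡_; _≢_; sym; trans; subst)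
open import Relation.Nullary using (¬_; Dec)
open import Relation.Nullary.Decidable using (map′; ¬?; _×-dec_; _→-dec_)

-- A finite simple graph on a linearly ordered vertex set.  Adjacency is
-- decidable, since an edge set is a subset of a finite set of pairs.
record OrderedGraph (n : ℕ) : Set₁ where
  field
    _~_    : Rel (Fin n) 0ℓ
    ~-sym  : Symmetric _~_
    irrefl : Irreflexive _≡_ _~_
    _~?_   : Decidable _~_

-- Vertices carry the labels 1, …, n, whereas toℕ counts from 0.
label : ∀ {n} → Fin n → ℕ
label v = suc (toℕ v)

module _ {n : ℕ} (G : OrderedGraph n) where
  open OrderedGraph G

  degree : Fin n → ℕ
  degree v = length (filter (v ~?_) (allFin n))

  -- Every degree is less than n, so the default value n only matters
  -- for the graph without vertices.
  δ : ℕ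
  δ = min n (map degree (allFin n))

------------------------------------------------------------------------
-- Copies and tilings

record Copy {h n : ℕ} (H : OrderedGraph h) (G : OrderedGraph n) : Set where
  private
    module H = OrderedGraph H
    module G = OrderedGraph G
  field
    φ                : Fin h → Fin n
    order-preserving : ∀ {i j} → i Fin.< j → φ i Fin.< φ j
    edge-preserving  : ∀ {i j} → i H.~ j → φ i G.~ φ j

record Tiling {h n : ℕ} (H : OrderedGraph h) (G : OrderedGraph n) : Set where
  field
    size : ℕ
    copy : Fin size → Copy H G
    disjoint : ∀ {s t} → s ≢ t → ∀ x y → Copy.φ (copy s) x ≢ Copy.φ (copy t) y

  Perfect : Set
  Perfect = ∀ v → ∃₂ λ s x → Copy.φ (copy s) x ≡ v

HasPerfectTiling : ∀ {h n} → OrderedGraph h → OrderedGraph n → Set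
HasPerfectTiling H G = ∃ λ (T : Tiling H G) → Tiling.Perfect T

------------------------------------------------------------------------
-- Interval chromatic number

module _ {h : ℕ} (H : OrderedGraph h) where
  open OrderedGraph H

  -- c sends each vertex to the index of its class.  The classes are
  -- nonempty, are intervals, and contain no edge of H.
  record IsIntervalPartition {k : ℕ} (c : Fin h → Fin k) : Set where
    constructor isIntervalPartition
    field
      nonempty    : StrictlySurjective _≡_ c
      interval    : ∀ u v w → u Fin.≤ v → v Fin.≤ w → c u ≡ c w → c v ≡ c u
      independent : ∀ u v → c u ≡ c v → ¬ (u ~ v)

  IntervalPartitionable : ℕ → Set
  IntervalPartitionable k = ∃ λ (c : Fin h → Fin k) → IsIntervalPartition c

  isIntervalPartition? : ∀ {k} (c : Fin h → Fin k) → Dec (IsIntervalPartition c)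
  isIntervalPartition? c = map′
    (λ (s , i , e) → isIntervalPartition s i e)
    (λ (isIntervalPartition s i e) → s , i , e)
    (Fin.all? (λ y → Fin.any? λ x → c x Fin.≟ y)
      ×-dec Fin.all? (λ u → Fin.all? λ v → Fin.all? λ w →
        (u Fin.≤? v) →-dec ((v Fin.≤? w) →-dec ((c u Fin.≟ c w) →-dec (c v Fin.≟ c u))))
      ×-dec Fin.all? (λ u → Fin.all? λ v → (c u Fin.≟ c v) →-dec ¬? (u ~? v)))

  isIntervalPartition-resp : ∀ {k} {c d : Fin h → Fin k} → (∀ v → c v ≡ d v) →
                             IsIntervalPartition c → IsIntervalPartition d
  isIntervalPartition-resp c≗d (isIntervalPartition s i e) = isIntervalPartition
    (λ y → let (x , cx≡y) = s y in x , trans (sym (c≗d x)) cx≡y)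
    (λ u v w u≤v v≤w du≡dw →
      trans (sym (c≗d v)) (trans (i u v w u≤v v≤w (back du≡dw)) (c≗d u)))
    (λ u v du≡dv → e u v (back du≡dv))
    where
    back : ∀ {u v} → _ ≡ _ → _ ≡ _
    back {u} {v} du≡dv = trans (c≗d u) (trans du≡dv (sym (c≗d v)))

  intervalPartitionable? : ∀ k → Dec (IntervalPartitionable k)
  intervalPartitionable? k = map′
    (λ (i , p) → finToFun i , p)
    (λ (c , p) → funToFin c ,
      isIntervalPartition-resp (λ v → sym (Fin.finToFun-funToFin c v)) p)
    (Fin.any? λ i → isIntervalPartition? (finToFun i))

  -- The partition into singletons shows that h is itself admissible.
  χ< : ℕ
  χ< = min h (filter intervalPartitionable? (upTo (suc h)))

------------------------------------------------------------------------
-- The parameter α*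

  -- The vertices with label in [ a , b ] form an independent set; the
  -- interval is empty when b < a.
  IndependentInterval : ℕ → ℕ → Set
  IndependentInterval a b = ∀ u v →
    a ≤ label u × label u ≤ b → a ≤ label v × label v ≤ b → ¬ (u ~ v)

  independentInterval? : ∀ a b → Dec (IndependentInterval a b)
  independentInterval? a b = Fin.all? λ u → Fin.all? λ v →
    in? u →-dec (in? v →-dec ¬? (u ~? v))
    where
    in? : ∀ u → Dec (a ≤ label u × label u ≤ b)
    in? u = (a ≤? label u) ×-dec (label u ≤? b)

  -- In both recursions the default value is the previous term, which is
  -- always admissible because the corresponding interval is empty.
  α⁺ : ℕ → ℕ
  α⁺ zero    = 0
  α⁺ (suc ℓ) = max (α⁺ ℓ) (filter (independentInterval? (suc (α⁺ ℓ))) (upTo (suc h)))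

  α⁻ : ℕ → ℕ
  α⁻ zero    = suc h
  α⁻ (suc ℓ) = min (α⁻ ℓ)
    (filter (λ k → independentInterval? k (α⁻ ℓ ∸ 1)) (map suc (upTo (suc h))))

  module _ .{{_ : NonZero h}} where

    -- 1 ≤ α⁻ ℓ ≤ h + 1, so the truncated subtraction is h - α⁻ ℓ + 1.
    α*-term : (ℓ : ℕ) .{{_ : NonZero ℓ}} → ℚ
    α*-term ℓ = ((+ α⁺ ℓ) ℚ./ (ℓ * h)) ℚ.⊓ ((+ (suc h ∸ α⁻ ℓ)) ℚ./ (ℓ * h))
      where instance _ = m*n≢0 ℓ h

    -- The minimum runs over ℓ = suc i with i < χ< ∸ 1.  For χ< ≥ 2 the
    -- default value is the term ℓ = 1 of this range; for χ< = 1 the range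
    -- is empty and α* has no meaning.
    α* : ℚ
    α* = ℚ-min (α*-term 1) (map (λ i → α*-term (suc i)) (upTo (χ< ∸ 1)))
      where open Data.List.Extrema (DecTotalOrder.totalOrder ℚ.≤-decTotalOrder)
              renaming (min to ℚ-min)

-- Let a/(ℓh) be a term attaining α*, say a = α⁺ ℓ, and n = qh.  Make the
-- first aq + 1 vertices of G at most ℓ consecutive independent blocks
-- of length at most s = ⌊aq/ℓ⌋ + 1, and add all other edges.  A copy of H
-- meets these vertices in an initial segment of H cut into ℓ independent
-- intervals, so in at most a vertices; a perfect tiling has q copies and
-- would cover only aq of them.  Every vertex has at most s non-neighbours
-- (itself included).  Terms coming from α⁻ are handled by reversing the
-- vertex order.

module Submission where

open import Defs
open import Data.Integer.Base as ℤ using (+_)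
open import Data.Nat.Base using (ℕ; _≤_; NonZero)
open import Data.Nat.Divisibility using (_∣_)
open import Data.Product.Base using (Σ-syntax; _×_)
open import Data.Rational.Base as ℚ using (1ℚ; floor)
open import Relation.Nullary using (¬_)

open import Data.Fin.Base as Fin using (Fin; toℕ; fromℕ<; inject≤; opposite; combine; remQuot; join; splitAt)
import Data.Fin.Properties as Fin
import Data.Integer.Properties as ℤ
open import Data.Integer.DivMod using ([n/d]*d≤n)
import Data.Integer.Tactic.RingSolver as ℤ-Solver
open import Data.List.Base using (List; map; filter; upTo; allFin; lookup)
open import Data.List.Extrema.Nat using (min≤⊤; min≤xs; v≤min⁺; ⊥≤max; xs≤max; argmin-sel; argmax-sel)
import Data.List.Extrema
open import Data.List.Membership.Propositional using (_∈_)
open import Data.List.Membership.Propositional.Properties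
import Data.List.Relation.Unary.All as All
import Data.List.Relation.Unary.All.Properties as All
open import Data.List.Relation.Unary.Any using (index)
open import Data.List.Relation.Unary.Any.Properties using (lookup-index)
open import Data.Nat.Base using (zero; suc; pred; _+_; _*_; _∸_; _<_; z≤n; s≤s; s≤s⁻¹; z<s)
open import Data.Nat.Divisibility using (divides-refl)
open import Data.Nat.DivMod using (_/_; _%_; m≡m%n+[m/n]*n; m/n≤m; m%n<n; m/n*n≤m;
  m<n*o⇒m/o<n; m*n/n≡m; /-monoˡ-≤)
import Data.Nat.Properties as ℕ
open import Data.Product.Base using (∃; _,_; proj₁; proj₂; uncurry)
import Data.Rational.Properties as ℚ
import Data.Rational.Unnormalised.Base as ℚᵘ
import Data.Rational.Unnormalised.Properties as ℚᵘ
open import Data.Sum.Base using (_⊎_; inj₁; inj₂)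
open import Data.Sum.Properties using (inj₁-injective; inj₂-injective)
open import Function.Base using (_∘_; id)
open import Function.Definitions using (Injective)
open import Relation.Binary.Bundles using (DecTotalOrder)
open import Relation.Binary.Definitions using (tri<; tri≈; tri>)
open import Relation.Binary.PropositionalEquality
open import Relation.Nullary using (yes; no; contradiction)
open import Relation.Nullary.Decidable using (¬?; decidable-stable)

-- Reversal

opposite-anti-≤ : ∀ {n} {u v : Fin n} → u Fin.≤ v → opposite v Fin.≤ opposite u
opposite-anti-≤ {n} {u} {v} u≤v = subst₂ _≤_ (sym (Fin.opposite-prop v)) (sym (Fin.opposite-prop u))
  (ℕ.∸-monoʳ-≤ n (s≤s u≤v))

opposite-anti-< : ∀ {n} {u v : Fin n} → u Fin.< v → opposite v Fin.< opposite u
opposite-anti-< {n} {u} {v} u<v = subst₂ _<_ (sym (Fin.opposite-prop v)) (sym (Fin.opposite-prop u))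
  (ℕ.∸-monoʳ-< (s≤s u<v) (Fin.toℕ<n v))

opposite-injective : ∀ {n} → Injective _≡_ _≡_ (opposite {n})
opposite-injective {x = u} {v} eq =
  trans (sym (Fin.opposite-involutive u)) (trans (cong opposite eq) (Fin.opposite-involutive v))

label-opposite : ∀ {n} (v : Fin n) → label (opposite v) ≡ suc n ∸ label v
label-opposite {n} v = trans (cong suc (Fin.opposite-prop v)) (sym (ℕ.+-∸-assoc 1 (Fin.toℕ<n v)))

label≤n : ∀ {n} (v : Fin n) → label v ≤ n
label≤n = Fin.toℕ<n

reflect-≤ : ∀ {n a x} → a ≤ n → n ∸ a ≤ x → n ∸ x ≤ a
reflect-≤ {n} {x = x} a≤n n∸a≤x = subst (n ∸ x ≤_) (ℕ.m∸[m∸n]≡n a≤n) (ℕ.∸-monoʳ-≤ n n∸a≤x)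

reflect-≥ : ∀ {n a x} → a ≤ n → x ≤ n ∸ a → a ≤ n ∸ x
reflect-≥ {n} {x = x} a≤n x≤n∸a = subst (_≤ n ∸ x) (ℕ.m∸[m∸n]≡n a≤n) (ℕ.∸-monoʳ-≤ n x≤n∸a)

reverse : ∀ {n} → OrderedGraph n → OrderedGraph n
reverse G = record
  { _~_    = λ u v → opposite u ~ opposite v
  ; ~-sym  = ~-sym
  ; irrefl = λ u≡v → irrefl (cong opposite u≡v)
  ; _~?_   = λ u v → opposite u ~? opposite v
  }
  where open OrderedGraph G

-- Conjugating each embedding by `opposite` on both sides reverses the order twice, so it is
-- monotone again. Contrapositively, an obstruction to tiling by `reverse H` yields one for `H`.
reverse-hasPerfectTiling : ∀ {h n} {H : OrderedGraph h} {G : OrderedGraph n} →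
  HasPerfectTiling H (reverse G) → HasPerfectTiling (reverse H) G
reverse-hasPerfectTiling {H = H} {G} (T , perfect) = T′ , perfect′
  where
  open Tiling T
  reverseCopy : Copy H (reverse G) → Copy (reverse H) G
  reverseCopy C = record
    { φ                = opposite ∘ φ ∘ opposite
    ; order-preserving = opposite-anti-< ∘ order-preserving ∘ opposite-anti-<
    -- Both reversed adjacencies unfold to exactly the adjacencies that the given copy relates.
    ; edge-preserving  = edge-preserving
    }
    where open Copy C
  T′ : Tiling (reverse H) G
  T′ = record
    { size     = size
    ; copy     = reverseCopy ∘ copy
    ; disjoint = λ s≢t x y → disjoint s≢t (opposite x) (opposite y) ∘ opposite-injective
    }
  perfect′ : Tiling.Perfect T′
  perfect′ v = let (s , x , φx≡v) = perfect (opposite v) in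
    s , opposite x ,
    trans (cong (opposite ∘ Copy.φ (copy s)) (Fin.opposite-involutive x))
      (trans (cong opposite φx≡v) (Fin.opposite-involutive v))

-- Allows greedy partitions built from the right to be compared with `χ< H`.
reverse-intervalPartitionable : ∀ {h} (H : OrderedGraph h) {k} →
  IntervalPartitionable (reverse H) k → IntervalPartitionable H k
reverse-intervalPartitionable H (c , isIntervalPartition nonempty interval independent) =
  c ∘ opposite , isIntervalPartition
    (λ y → let (x , cx≡y) = nonempty y in
      opposite x , trans (cong c (Fin.opposite-involutive x)) cx≡y)
    (λ u v w u≤v v≤w cu≡cw → trans
      (interval _ _ _ (opposite-anti-≤ v≤w) (opposite-anti-≤ u≤v) (sym cu≡cw)) (sym cu≡cw))
    (λ u v cu≡cv u~v → independent _ _ cu≡cv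
      (subst₂ _~_ (sym (Fin.opposite-involutive u)) (sym (Fin.opposite-involutive v)) u~v))
  where open OrderedGraph H

-- Reversal sends a label `x` to `h + 1 - x`. The bounds on `a` and `b` make this reflection an
-- involution under truncated subtraction.
reverse-independent⁺ : ∀ {h} (H : OrderedGraph h) {a b} → a ≤ suc h → b ≤ suc h →
  IndependentInterval H a b → IndependentInterval (reverse H) (suc h ∸ b) (suc h ∸ a)
reverse-independent⁺ {h} H {a} {b} a≤ b≤ ind u v u∈ v∈ = ind _ _ (reflect u u∈) (reflect v v∈)
  where
  reflect : ∀ u → suc h ∸ b ≤ label u × label u ≤ suc h ∸ a →
            a ≤ label (opposite u) × label (opposite u) ≤ b
  reflect u (lo , hi) rewrite label-opposite u = reflect-≥ a≤ hi , reflect-≤ b≤ lo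

reverse-independent⁻ : ∀ {h} (H : OrderedGraph h) {a b} →
  IndependentInterval (reverse H) (suc h ∸ b) (suc h ∸ a) → IndependentInterval H a b
reverse-independent⁻ {h} H {a} {b} ind u v u∈ v∈ u~v = ind _ _ (reflect u u∈) (reflect v v∈)
  (subst₂ _~_ (sym (Fin.opposite-involutive u)) (sym (Fin.opposite-involutive v)) u~v)
  where
  open OrderedGraph H
  reflect : ∀ u → a ≤ label u × label u ≤ b →
            suc h ∸ b ≤ label (opposite u) × label (opposite u) ≤ suc h ∸ a
  reflect u (lo , hi) rewrite label-opposite u = ℕ.∸-monoʳ-≤ (suc h) hi , ℕ.∸-monoʳ-≤ (suc h) lo

-- Greedy partitions into independent intervals

-- Common form of `α⁺` on `H` and of `suc h ∸ α⁻` on `reverse H`, so that both kinds of terms of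
-- `α*` are treated at once. The values of `f` are the right ends of the greedy intervals.
record Greedy {h} (H : OrderedGraph h) (f : ℕ → ℕ) : Set where
  field
    start       : f 0 ≡ 0
    bounded     : ∀ ℓ → f ℓ ≤ h
    step        : ∀ ℓ → f ℓ ≤ f (suc ℓ)
    independent : ∀ ℓ → IndependentInterval H (suc (f ℓ)) (f (suc ℓ))
    maximal     : ∀ ℓ {k} → k ≤ h → IndependentInterval H (suc (f ℓ)) k → k ≤ f (suc ℓ)

module _ {h} (H : OrderedGraph h) where
  open OrderedGraph H

  emptyInterval-independent : ∀ {a b} → b < a → IndependentInterval H a b
  emptyInterval-independent b<a u v (a≤u , u≤b) _ = contradiction (ℕ.≤-trans a≤u u≤b) (ℕ.<⇒≱ b<a)

  singleton-independent : ∀ a → IndependentInterval H a a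
  singleton-independent a u v (a≤u , u≤a) (a≤v , v≤a) = irrefl
    (Fin.toℕ-injective (ℕ.suc-injective
      (trans (ℕ.≤-antisym u≤a a≤u) (ℕ.≤-antisym a≤v v≤a))))

  χ<≤h : χ< H ≤ h
  χ<≤h = min≤⊤ h (filter (intervalPartitionable? H) (upTo (suc h)))

  χ<-minimal : ∀ {k} → k ≤ h → IntervalPartitionable H k → χ< H ≤ k
  χ<-minimal k≤h p =
    All.lookup (min≤xs h _) (∈-filter⁺ (intervalPartitionable? H) (∈-upTo⁺ (s≤s k≤h)) p)

module _ {h} {H : OrderedGraph h} {f} (greedy : Greedy H f) where
  open Greedy greedy

  greedy-mono : ∀ {i j} → i ≤ j → f i ≤ f j
  greedy-mono {i} {j} i≤j = subst (λ j → f i ≤ f j) (ℕ.m∸n+n≡m i≤j) (go (j ∸ i))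
    where
    go : ∀ d → f i ≤ f (d + i)
    go zero    = ℕ.≤-refl
    go (suc d) = ℕ.≤-trans (go d) (step (d + i))

  greedy-strict : ∀ {ℓ} → f ℓ < h → f ℓ < f (suc ℓ)
  greedy-strict {ℓ} fℓ<h = maximal ℓ fℓ<h (singleton-independent H (suc (f ℓ)))

  locate : ∀ ℓ {x} → 0 < x → x ≤ f ℓ → ∃ λ (i : Fin ℓ) → f (toℕ i) < x × x ≤ f (suc (toℕ i))
  locate zero    0<x x≤f0 = contradiction (subst (_ ≤_) start x≤f0) (ℕ.<⇒≱ 0<x)
  locate (suc ℓ) {x} 0<x x≤f with x ℕ.≤? f ℓ
  ... | no x≰fℓ = Fin.fromℕ ℓ ,
        subst (λ i → f i < x) (sym (Fin.toℕ-fromℕ ℓ)) (ℕ.≰⇒> x≰fℓ) ,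
        subst (λ i → x ≤ f (suc i)) (sym (Fin.toℕ-fromℕ ℓ)) x≤f
  ... | yes x≤fℓ = let (i , lo , hi) = locate ℓ 0<x x≤fℓ in Fin.inject₁ i ,
        subst (λ i → f i < x) (sym (Fin.toℕ-inject₁ i)) lo ,
        subst (λ i → x ≤ f (suc i)) (sym (Fin.toℕ-inject₁ i)) hi

  -- Otherwise `y ≤ f (suc j) ≤ f i < x`. Used in both directions with `x = y`, this makes the class
  -- of a label unique.
  class-≤ : ∀ {i j x y} → f i < x → x ≤ y → y ≤ f (suc j) → i ≤ j
  class-≤ fi<x x≤y y≤fj = ℕ.≮⇒≥ λ j<i →
    ℕ.<⇒≱ fi<x (ℕ.≤-trans x≤y (ℕ.≤-trans y≤fj (greedy-mono j<i)))

  greedy-partition : ∀ {ℓ} → h ≤ f ℓ → (∀ (i : Fin ℓ) → f (toℕ i) < h) → IntervalPartitionable H ℓ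
  greedy-partition {ℓ} h≤fℓ f<h = class , isIntervalPartition
    -- Class `y` contains its first vertex, with label `f y + 1`: this vertex exists since
    -- `f y < h`, and it lies in the class since `f` still grows there.
    (λ y → let x = fromℕ< (f<h y) ; label≡ = cong suc (Fin.toℕ-fromℕ< (f<h y)) in
      x , class-unique (subst (f (toℕ y) <_) (sym label≡) ℕ.≤-refl)
                       (subst (_≤ f (suc (toℕ y))) (sym label≡) (greedy-strict (f<h y))))
    (λ u v w u≤v v≤w cu≡cw → class-unique
      (ℕ.<-≤-trans (lower u) (s≤s u≤v))
      (ℕ.≤-trans (s≤s v≤w) (subst (λ i → label w ≤ f (suc (toℕ i))) (sym cu≡cw) (upper w))))
    (λ u v cu≡cv → independent (toℕ (class u)) u v (lower u , upper u)
      (subst (λ i → f (toℕ i) < label v) (sym cu≡cv) (lower v) ,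
       subst (λ i → label v ≤ f (suc (toℕ i))) (sym cu≡cv) (upper v)))
    where
    located : ∀ v → ∃ λ (i : Fin ℓ) → f (toℕ i) < label v × label v ≤ f (suc (toℕ i))
    located v = locate ℓ z<s (ℕ.≤-trans (label≤n v) h≤fℓ)
    class : Fin h → Fin ℓ
    class = proj₁ ∘ located
    lower : ∀ v → f (toℕ (class v)) < label v
    lower = proj₁ ∘ proj₂ ∘ located
    upper : ∀ v → label v ≤ f (suc (toℕ (class v)))
    upper = proj₂ ∘ proj₂ ∘ located
    class-unique : ∀ {v i} → f (toℕ i) < label v → label v ≤ f (suc (toℕ i)) → class v ≡ i
    class-unique {v} lo hi = Fin.toℕ-injective (ℕ.≤-antisym
      (class-≤ (lower v) ℕ.≤-refl hi) (class-≤ lo ℕ.≤-refl (upper v)))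

  -- Classes must be nonempty, so the partition stops at the least `k` with `h ≤ f k`.
  greedy-exhausts⇒partitionable : ∀ ℓ → h ≤ f ℓ → ∃ λ k → k ≤ ℓ × IntervalPartitionable H k
  greedy-exhausts⇒partitionable zero h≤f0 = 0 , z≤n , greedy-partition h≤f0 λ ()
  greedy-exhausts⇒partitionable (suc ℓ) h≤f with h ℕ.≤? f ℓ
  ... | yes h≤fℓ = let (k , k≤ℓ , p) = greedy-exhausts⇒partitionable ℓ h≤fℓ in
                   k , ℕ.m≤n⇒m≤1+n k≤ℓ , p
  ... | no  h≰fℓ = suc ℓ , ℕ.≤-refl , greedy-partition h≤f λ i →
                   ℕ.≤-<-trans (greedy-mono (s≤s⁻¹ (Fin.toℕ<n i))) (ℕ.≰⇒> h≰fℓ)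

-- If `ℓ` greedy intervals covered everything, `H` would have a partition into fewer than `χ< H`
-- intervals. The second graph `H′` leaves room for `reverse H`.
greedy-unexhausted : ∀ {h} (H : OrderedGraph h) {H′ f ℓ} → Greedy H′ f →
  (∀ {k} → IntervalPartitionable H′ k → IntervalPartitionable H k) → ℓ < χ< H → f ℓ < h
greedy-unexhausted {h} H {f = f} {ℓ} greedy transfer ℓ<χ = ℕ.≰⇒> λ h≤fℓ →
  let (k , k≤ℓ , p) = greedy-exhausts⇒partitionable greedy ℓ h≤fℓ
      k<χ = ℕ.≤-<-trans k≤ℓ ℓ<χ
  -- `χ<` is a minimum over numbers up to `h` only; here `k < χ< H ≤ h`.
  in ℕ.<⇒≱ k<χ (χ<-minimal H (ℕ.≤-trans (ℕ.<⇒≤ k<χ) (χ<≤h H)) (transfer p))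

α⁺-greedy : ∀ {h} (H : OrderedGraph h) → Greedy H (α⁺ H)
α⁺-greedy {h} H = record
  { start       = refl
  ; bounded     = bounded
  ; step        = λ ℓ → ⊥≤max (α⁺ H ℓ) (candidates ℓ)
  ; independent = independent
  ; maximal     = λ ℓ k≤h ind → All.lookup (xs≤max (α⁺ H ℓ) (candidates ℓ))
      (∈-filter⁺ (independentInterval? H _) (∈-upTo⁺ (s≤s k≤h)) ind)
  }
  where
  candidates : ℕ → List ℕ
  candidates ℓ = filter (independentInterval? H (suc (α⁺ H ℓ))) (upTo (suc h))
  candidate : ∀ ℓ {k} → k ∈ candidates ℓ → k < suc h × IndependentInterval H (suc (α⁺ H ℓ)) k
  candidate ℓ k∈ = let (k∈upTo , ind) = ∈-filter⁻ (independentInterval? H _) {xs = upTo (suc h)} k∈ in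
    ∈-upTo⁻ k∈upTo , ind
  bounded : ∀ ℓ → α⁺ H ℓ ≤ h
  bounded zero    = z≤n
  bounded (suc ℓ) with argmax-sel id (α⁺ H ℓ) (candidates ℓ)
  ... | inj₁ eq = subst (_≤ h) (sym eq) (bounded ℓ)
  ... | inj₂ α∈ = s≤s⁻¹ (proj₁ (candidate ℓ α∈))
  independent : ∀ ℓ → IndependentInterval H (suc (α⁺ H ℓ)) (α⁺ H (suc ℓ))
  -- The maximum is either the default, whose interval is empty, or a candidate from the list.
  independent ℓ with argmax-sel id (α⁺ H ℓ) (candidates ℓ)
  ... | inj₁ eq = subst (IndependentInterval H _) (sym eq) (emptyInterval-independent H ℕ.≤-refl)
  ... | inj₂ α∈ = proj₂ (candidate ℓ α∈)

-- Reflection turns the interval from `α⁻ H (suc ℓ)` to `α⁻ H ℓ ∸ 1` into a greedy interval of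
-- `reverse H`, and minimality of its left end into maximality of the right end.
α⁻-greedy : ∀ {h} (H : OrderedGraph h) → Greedy (reverse H) (λ ℓ → suc h ∸ α⁻ H ℓ)
α⁻-greedy {h} H = record
  { start       = ℕ.n∸n≡0 (suc h)
  ; bounded     = λ ℓ → ℕ.∸-monoʳ-≤ (suc h) (positive ℓ)
  ; step        = λ ℓ → ℕ.∸-monoʳ-≤ (suc h) (min≤⊤ (α⁻ H ℓ) (candidates ℓ))
  ; independent = λ ℓ → subst (λ a → IndependentInterval (reverse H) a (suc h ∸ α⁻ H (suc ℓ)))
      (lower-end ℓ)
      (reverse-independent⁺ H (bounded (suc ℓ)) (ℕ.≤-trans ℕ.pred[n]≤n (bounded ℓ)) (independent ℓ))
  -- A right end `k` in `reverse H` corresponds to the candidate `suc h ∸ k` for `α⁻ H (suc ℓ)`; it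
  -- is positive because `k ≤ h`.
  ; maximal     = λ ℓ {k} k≤h ind → reflect-≥ (ℕ.m≤n⇒m≤1+n k≤h)
      (All.lookup (min≤xs (α⁻ H ℓ) (candidates ℓ))
      (∈-filter⁺ (λ k → independentInterval? H k (α⁻ H ℓ ∸ 1))
        (subst (_∈ map suc (upTo (suc h))) (sym (ℕ.+-∸-assoc 1 k≤h))
          (∈-map⁺ suc (∈-upTo⁺ (s≤s (ℕ.m∸n≤m h k)))))
        (reverse-independent⁻ H {a = suc h ∸ k} (subst₂ (IndependentInterval (reverse H))
          (sym (lower-end ℓ)) (sym (ℕ.m∸[m∸n]≡n (ℕ.m≤n⇒m≤1+n k≤h))) ind))))
  }
  where
  candidates : ℕ → List ℕ
  candidates ℓ = filter (λ k → independentInterval? H k (α⁻ H ℓ ∸ 1)) (map suc (upTo (suc h)))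
  candidate : ∀ ℓ {k} → k ∈ candidates ℓ → 1 ≤ k × IndependentInterval H k (α⁻ H ℓ ∸ 1)
  candidate ℓ k∈
    with k∈map , ind ← ∈-filter⁻ (λ k → independentInterval? H k (α⁻ H ℓ ∸ 1))
                         {xs = map suc (upTo (suc h))} k∈
    with _ , _ , refl ← ∈-map⁻ suc k∈map = z<s , ind
  positive : ∀ ℓ → 1 ≤ α⁻ H ℓ
  positive zero    = z<s
  positive (suc ℓ) = v≤min⁺ (positive ℓ)
    (All.tabulate {xs = candidates ℓ} λ {k} k∈ → proj₁ (candidate ℓ {k} k∈))
  bounded : ∀ ℓ → α⁻ H ℓ ≤ suc h
  bounded zero    = ℕ.≤-refl
  bounded (suc ℓ) = ℕ.≤-trans (min≤⊤ (α⁻ H ℓ) (candidates ℓ)) (bounded ℓ)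
  independent : ∀ ℓ → IndependentInterval H (α⁻ H (suc ℓ)) (α⁻ H ℓ ∸ 1)
  independent ℓ with argmin-sel id (α⁻ H ℓ) (candidates ℓ)
  ... | inj₁ eq = subst (λ k → IndependentInterval H k (α⁻ H ℓ ∸ 1)) (sym eq)
                    (emptyInterval-independent H (ℕ.≤-reflexive (ℕ.m+[n∸m]≡n (positive ℓ))))
  ... | inj₂ α∈ = proj₂ (candidate ℓ α∈)
  lower-end : ∀ ℓ → suc h ∸ (α⁻ H ℓ ∸ 1) ≡ suc (suc h ∸ α⁻ H ℓ)
  lower-end ℓ with α⁻ H ℓ | positive ℓ | bounded ℓ
  ... | suc b | _ | s≤s b≤h = ℕ.+-∸-assoc 1 b≤h

-- Complete multipartite graphs

multipartite : ∀ {n} → (Fin n → ℕ) → OrderedGraph n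
multipartite colour = record
  { _~_    = λ u v → colour u ≢ colour v
  ; ~-sym  = λ u≁v → u≁v ∘ sym
  ; irrefl = λ u≡v u≁v → u≁v (cong colour u≡v)
  ; _~?_   = λ u v → ¬? (colour u ℕ.≟ colour v)
  }

-- As irrefl gives ¬ (v ~ v), each vertex counts as its own non-neighbour.
record CoDegreeBounded {n} (G : OrderedGraph n) (s : ℕ) : Set where
  open OrderedGraph G
  field
    slot           : Fin n → Fin s
    slot-injective : ∀ {v u w} → ¬ (v ~ u) → ¬ (v ~ w) → slot u ≡ slot w → u ≡ w

reverse-coDegreeBounded : ∀ {n} {G : OrderedGraph n} {s} →
  CoDegreeBounded G s → CoDegreeBounded (reverse G) s
reverse-coDegreeBounded b = record
  { slot           = slot ∘ opposite
  ; slot-injective = λ v≁u v≁w → opposite-injective ∘ slot-injective v≁u v≁w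
  }
  where open CoDegreeBounded b

module _ {n} {G : OrderedGraph n} {s} (b : CoDegreeBounded G s) where
  open OrderedGraph G
  open CoDegreeBounded b

  -- Neighbours of `v` are encoded by their position in the filtered list and non-neighbours by
  -- their slot, which injects all vertices into a set of size `degree G v + s`.
  n≤degree+s : ∀ v → n ≤ degree G v + s
  n≤degree+s v = Fin.injective⇒≤ {f = join (degree G v) s ∘ encode} λ {u} {w} eq →
    encode-injective u w (trans (sym (Fin.splitAt-join _ s (encode u)))
      (trans (cong (splitAt (degree G v)) eq) (Fin.splitAt-join _ s (encode w))))
    where
    neighbour : ∀ {u} → v ~ u → u ∈ filter (v ~?_) (allFin n)
    neighbour {u} v~u = ∈-filter⁺ (v ~?_) (∈-allFin u) v~u
    encode : Fin n → Fin (degree G v) ⊎ Fin s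
    encode u with v ~? u
    ... | yes v~u = inj₁ (index (neighbour v~u))
    ... | no  _   = inj₂ (slot u)
    encode-injective : ∀ u w → encode u ≡ encode w → u ≡ w
    encode-injective u w eq with v ~? u | v ~? w
    encode-injective u w eq | yes v~u | yes v~w = trans (lookup-index (neighbour v~u))
      (trans (cong (lookup (filter (v ~?_) (allFin n))) (inj₁-injective eq))
        (sym (lookup-index (neighbour v~w))))
    encode-injective u w () | yes _   | no _
    encode-injective u w () | no _    | yes _
    encode-injective u w eq | no v≁u  | no v≁w  = slot-injective v≁u v≁w (inj₂-injective eq)

  n∸s≤δ : n ∸ s ≤ δ G
  -- The first argument deals with the default value `n` in `δ`.
  n∸s≤δ = v≤min⁺ (ℕ.m∸n≤m n s) (All.map⁺ {xs = allFin n} (All.tabulate λ {v} _ →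
    ℕ.m≤n+o⇒m∸n≤o n s (subst (n ≤_) (ℕ.+-comm _ s) (n≤degree+s v))))

-- Counting vertices in tilings

module _ {h n} {H : OrderedGraph h} {G : OrderedGraph n} where

  Copy-injective : (C : Copy H G) → Injective _≡_ _≡_ (Copy.φ C)
  Copy-injective C {x} {y} φx≡φy with Fin.<-cmp x y
  ... | tri< x<y _ _ = contradiction (order-preserving x<y) (ℕ.<-irrefl (cong toℕ φx≡φy))
    where open Copy C
  ... | tri≈ _ x≡y _ = x≡y
  ... | tri> _ _ y<x = contradiction (order-preserving y<x) (ℕ.<-irrefl (cong toℕ (sym φx≡φy)))
    where open Copy C

  Copy-mono : (C : Copy H G) → ∀ {x y} → x Fin.≤ y → Copy.φ C x Fin.≤ Copy.φ C y
  Copy-mono C {x} {y} x≤y with Fin.<-cmp x y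
  ... | tri< x<y _ _ = ℕ.<⇒≤ (Copy.order-preserving C x<y)
  ... | tri≈ _ refl _ = ℕ.≤-refl
  ... | tri> _ _ y<x = contradiction x≤y (ℕ.<⇒≱ y<x)

  -- Copies are injective and pairwise disjoint, so the pairs of a copy and a vertex of `H` inject
  -- into the vertices of `G`.
  tiling-size : (T : Tiling H G) → Tiling.size T * h ≤ n
  tiling-size T = Fin.injective⇒≤ {f = place ∘ remQuot h} λ {i} {j} eq →
    trans (sym (Fin.combine-remQuot {size} h i))
      (trans (cong (uncurry combine) (place-injective (remQuot h i) (remQuot h j) eq))
        (Fin.combine-remQuot {size} h j))
    where
    open Tiling T
    place : Fin size × Fin h → Fin n
    place (s , x) = Copy.φ (copy s) x
    place-injective : ∀ p q → place p ≡ place q → p ≡ q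
    place-injective (s , x) (t , y) eq with s Fin.≟ t
    ... | no  s≢t  = contradiction eq (disjoint s≢t x y)
    ... | yes refl = cong (s ,_) (Copy-injective (copy s) eq)

  -- Each of the first `m` vertices is determined by the copy covering it and its position there,
  -- and by hypothesis only the first `a` positions occur.
  perfect⇒prefix-bound : ∀ {m a} → m ≤ n → ((T , _) : HasPerfectTiling H G) →
    (∀ (C : Copy H G) x → toℕ (Copy.φ C x) < m → toℕ x < a) → m ≤ Tiling.size T * a
  perfect⇒prefix-bound {m} {a} m≤n (T , perfect) few =
    Fin.injective⇒≤ {f = λ v → combine (s v) (fromℕ< (x<a v))} λ {u} {v} eq →
      let (s≡ , x≡) = Fin.combine-injective _ _ _ _ eq in
      Fin.inject≤-injective m≤n m≤n u v (trans (sym (covers u))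
        (trans (cong₂ (λ s → Copy.φ (copy s)) s≡
          (Fin.toℕ-injective (Fin.fromℕ<-injective _ _ (x<a u) (x<a v) x≡))) (covers v)))
    where
    open Tiling T
    s : Fin m → Fin size
    s v = proj₁ (perfect (inject≤ v m≤n))
    x : Fin m → Fin h
    x v = proj₁ (proj₂ (perfect (inject≤ v m≤n)))
    covers : ∀ v → Copy.φ (copy (s v)) (x v) ≡ inject≤ v m≤n
    covers v = proj₂ (proj₂ (perfect (inject≤ v m≤n)))
    x<a : ∀ v → toℕ (x v) < a
    x<a v = few (copy (s v)) (x v)
      (subst (_< m) (sym (trans (cong toℕ (covers v)) (Fin.toℕ-inject≤ v m≤n))) (Fin.toℕ<n v))

-- The block graph and the copies in it

module _ (m s : ℕ) .{{_ : NonZero s}} where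

  -- The two kinds of colours do not clash: x / s < m whenever x < m.
  blockColour : ℕ → ℕ
  blockColour x with x ℕ.<? m
  ... | yes _ = x / s
  ... | no  _ = x

  blockColour-block : ∀ {x y} → x < m → y < m → x / s ≡ y / s → blockColour x ≡ blockColour y
  blockColour-block {x} {y} x<m y<m eq with x ℕ.<? m | y ℕ.<? m
  ... | yes _   | yes _   = eq
  ... | no  x≮m | _       = contradiction x<m x≮m
  ... | yes _   | no  y≮m = contradiction y<m y≮m

  -- Among the first `m` vertices, colour and residue are quotient and remainder modulo `s`; beyond
  -- them the colour is the vertex itself. Hence residues can serve as slots.
  blockColour-%-injective : ∀ {x y} → blockColour x ≡ blockColour y → x % s ≡ y % s → x ≡ y
  blockColour-%-injective {x} {y} col rem with x ℕ.<? m | y ℕ.<? m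
  ... | yes _   | yes _   = trans (m≡m%n+[m/n]*n x s)
                              (trans (cong₂ (λ r k → r + k * s) rem col) (sym (m≡m%n+[m/n]*n y s)))
  -- Equal colours would give `y = x / s ≤ x < m ≤ y`.
  ... | yes x<m | no  y≮m = contradiction (ℕ.<-≤-trans x<m (ℕ.≮⇒≥ y≮m))
                              (ℕ.≤⇒≯ (subst (_≤ x) col (m/n≤m x s)))
  ... | no  x≮m | yes y<m = contradiction (ℕ.<-≤-trans y<m (ℕ.≮⇒≥ x≮m))
                              (ℕ.≤⇒≯ (subst (_≤ y) (sym col) (m/n≤m y s)))
  ... | no  _   | no  _   = col

  blockGraph : ∀ n → OrderedGraph n
  blockGraph n = multipartite (blockColour ∘ toℕ)

  blockGraph-coDegreeBounded : ∀ n → CoDegreeBounded (blockGraph n) s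
  blockGraph-coDegreeBounded n = record
    { slot           = λ v → fromℕ< (m%n<n (toℕ v) s)
    ; slot-injective = λ {v} {u} {w} v≁u v≁w eq → Fin.toℕ-injective (blockColour-%-injective
        -- Non-adjacency is doubly negated equality of colours, so `u` and `w` both have the colour
        -- of `v`.
        (trans (sym (decidable-stable (_ ℕ.≟ _) v≁u)) (decidable-stable (_ ℕ.≟ _) v≁w))
        (Fin.fromℕ<-injective _ _ (m%n<n (toℕ u) s) (m%n<n (toℕ w) s) eq))
    }

  /-unique : ∀ i {y} → i * s ≤ y → y < suc i * s → y / s ≡ i
  /-unique i {y} lo hi = ℕ.≤-antisym (s≤s⁻¹ (m<n*o⇒m/o<n {y} {suc i} {s} hi))
    (subst (_≤ y / s) (m*n/n≡m i s) (/-monoˡ-≤ s lo))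

  -- A copy of H meets the first i blocks in i independent intervals, and
  -- the greedy partition covers the longest initial segment.
  copy-meets-blocks : ∀ {h n} {H : OrderedGraph h} {f} → Greedy H f → (C : Copy H (blockGraph n)) →
    ∀ i x → toℕ (Copy.φ C x) < m → toℕ (Copy.φ C x) < i * s → label x ≤ f i
  -- Induction on `i`, with the case `i = 0` absurd. The vertices with labels from `f i + 1` to that
  -- of `x` all land in block `i`, so they are independent and `maximal` applies.
  copy-meets-blocks {H = H} {f} greedy C (suc i) x φx<m φx<is = maximal i (label≤n x)
    λ u w (lo , u≤x) (lo′ , w≤x) u~w → edge-preserving u~w
      (blockColour-block (below u u≤x φx<m) (below w w≤x φx<m)
        (trans (block u lo u≤x) (sym (block w lo′ w≤x))))
    where
    open Greedy greedy
    open Copy C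
    below : ∀ u → label u ≤ label x → ∀ {b} → toℕ (φ x) < b → toℕ (φ u) < b
    below u u≤x = ℕ.≤-<-trans (Copy-mono C (s≤s⁻¹ u≤x))
    block : ∀ u → suc (f i) ≤ label u → label u ≤ label x → toℕ (φ u) / s ≡ i
    block u lo u≤x = /-unique i
      -- If `u` landed before block `i`, the induction hypothesis would give `label u ≤ f i`.
      (ℕ.≮⇒≥ λ φu<is → ℕ.<⇒≱ lo (copy-meets-blocks greedy C i u (below u u≤x φx<m) φu<is))
      (below u u≤x φx<is)

-- The least `s` with `a * q < ℓ * s`, so that `ℓ` blocks hold `a * q + 1` vertices.
blockLength : (a q ℓ : ℕ) .{{_ : NonZero ℓ}} → ℕ
blockLength a q ℓ = suc (a * q / ℓ)

greedy-obstruction : ∀ {h q} {H : OrderedGraph h} {f} → Greedy H f → ∀ ℓ .{{_ : NonZero ℓ}} →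
  .{{_ : NonZero q}} → f ℓ < h →
  Σ[ G ∈ OrderedGraph (q * h) ] CoDegreeBounded G (blockLength (f ℓ) q ℓ) × ¬ HasPerfectTiling H G
greedy-obstruction {suc h} {q} {H} {f} greedy ℓ fℓ<h =
  blockGraph m s n , blockGraph-coDegreeBounded m s n , λ P@(T , _) →
    ℕ.<⇒≱ (perfect⇒prefix-bound m≤n P λ C x φx<m →
        copy-meets-blocks m s greedy C ℓ x φx<m (ℕ.<-≤-trans φx<m m≤ℓs))
      -- Since `n = q * suc h`, there are at most `q` copies, which cover at most `a * q < m`
      -- vertices of the prefix.
      (ℕ.≤-trans (ℕ.*-monoˡ-≤ a (ℕ.*-cancelʳ-≤ (Tiling.size T) q (suc h) (tiling-size T)))
        (ℕ.≤-reflexive (ℕ.*-comm q a)))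
  where
  a = f ℓ
  n = q * suc h
  m = suc (a * q)
  s = blockLength a q ℓ
  m≤n : m ≤ n
  m≤n = subst (a * q <_) (ℕ.*-comm (suc h) q) (ℕ.*-monoˡ-< q fℓ<h)
  m≤ℓs : m ≤ ℓ * s
  m≤ℓs = begin-strict
    a * q                               ≡⟨ m≡m%n+[m/n]*n (a * q) ℓ ⟩
    a * q % ℓ + a * q / ℓ * ℓ           <⟨ ℕ.+-monoˡ-< _ (m%n<n (a * q) ℓ) ⟩
    ℓ + a * q / ℓ * ℓ                   ≡⟨ ℕ.*-comm s ℓ ⟩
    ℓ * s                               ∎
    where open ℕ.≤-Reasoning

-- The parameter α*

α*-attained : ∀ {h} .{{_ : NonZero h}} (H : OrderedGraph h) → 2 ≤ χ< H →
  ∃ λ i → suc i < χ< H × α* H ≡ α*-term H (suc i)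
α*-attained H 2≤χ = attained (ℚ-argmin-sel id (term 0) (map term indices))
  where
  open Data.List.Extrema (DecTotalOrder.totalOrder ℚ.≤-decTotalOrder) using ()
    renaming (argmin-sel to ℚ-argmin-sel)
  term : ℕ → ℚ.ℚ
  term i = α*-term H (suc i)
  indices : List ℕ
  indices = upTo (χ< H ∸ 1)
  attained : α* H ≡ term 0 ⊎ α* H ∈ map term indices → ∃ λ i → suc i < χ< H × α* H ≡ term i
  -- The default term `ℓ = 1` belongs to the range because `2 ≤ χ< H`.
  attained (inj₁ eq) = 0 , 2≤χ , eq
  attained (inj₂ α∈) = let (i , i∈ , eq) = ∈-map⁻ term {xs = indices} α∈ in
    i , ℕ.≤-trans (s≤s (∈-upTo⁻ i∈)) (ℕ.≤-reflexive (ℕ.m+[n∸m]≡n (ℕ.<⇒≤ 2≤χ))) , eq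

-- Rounding in the degree bound

floor-≤ : ∀ {p} {k : ℤ.ℤ} → ℚ.toℚᵘ p ℚᵘ.≤ ℚᵘ.mkℚᵘ k 0 → floor p ℤ.≤ k
-- Multiplied by the denominator of `p`, the floor is at most the numerator, which is at most `k`
-- times the denominator.
floor-≤ {p@record{}} {k} (ℚᵘ.*≤* p≤k) = ℤ.*-cancelʳ-≤-pos _ _ (ℚ.↧ p)
  (ℤ.≤-trans ([n/d]*d≤n (ℚ.↥ p) (ℚ.↧ p)) (subst (ℤ._≤ k ℤ.* ℚ.↧ p) (ℤ.*-identityʳ (ℚ.↥ p)) p≤k))

-- With `n = q * h` and `t = a * q / ℓ` rounded down, the product is `n` minus the exact quotient,
-- hence at most `n ∸ t`. The block length is `t + 1`, which accounts for the subtracted 1.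
degree-bound : ∀ a h q ℓ .{{_ : NonZero h}} .{{_ : NonZero ℓ}} .{{_ : NonZero (ℓ * h)}} → a ≤ h →
  floor ((1ℚ ℚ.- (+ a) ℚ./ (ℓ * h)) ℚ.* ((+ (q * h)) ℚ./ 1)) ℤ.- (+ 1)
    ℤ.≤ + (q * h ∸ blockLength a q ℓ)
degree-bound a h@(suc h-1) q ℓ@(suc ℓ-1) a≤h = begin
  floor x ℤ.- + 1            ≤⟨ ℤ.+-monoˡ-≤ (ℤ.- + 1) (floor-≤ x≤n∸t) ⟩
  + (n ∸ t) ℤ.- + 1          ≤⟨ pred-≤ (n ∸ t) ⟩
  + pred (n ∸ t)             ≡⟨ cong +_ (ℕ.pred[m∸n]≡m∸[1+n] n t) ⟩
  + (n ∸ suc t)              ∎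
  where
  open ℤ.≤-Reasoning
  n = q * h
  t = a * q / ℓ
  D = ℓ * h
  x = (1ℚ ℚ.- (+ a) ℚ./ D) ℚ.* ((+ n) ℚ./ 1)
  pred-≤ : ∀ k → + k ℤ.- + 1 ℤ.≤ + pred k
  -- At zero the integer difference is -1 while the truncated one is 0.
  pred-≤ zero    = ℤ.-≤+
  pred-≤ (suc k) = ℤ.≤-refl
  t≤n : t ≤ n
  t≤n = ℕ.≤-trans (m/n≤m (a * q) ℓ)
    (ℕ.≤-trans (ℕ.*-monoˡ-≤ q a≤h) (ℕ.≤-reflexive (ℕ.*-comm h q)))
  tD≤an : t * D ≤ a * n
  tD≤an = subst₂ _≤_ (ℕ.*-assoc t ℓ h) (ℕ.*-assoc a q h) (ℕ.*-monoˡ-≤ h (m/n*n≤m (a * q) ℓ))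
  -- Unnormalised fractions keep numerator and denominator explicit, which reduces the estimate to
  -- `tD≤an` over the integers.
  xᵘ = (ℚᵘ.1ℚᵘ ℚᵘ.- ((+ a) ℚᵘ./ D)) ℚᵘ.* ((+ n) ℚᵘ./ 1)
  x≃xᵘ : ℚ.toℚᵘ x ℚᵘ.≃ xᵘ
  x≃xᵘ = ℚᵘ.≃-trans (ℚ.toℚᵘ-homo-* (1ℚ ℚ.- (+ a) ℚ./ D) ((+ n) ℚ./ 1)) (ℚᵘ.*-cong
    (ℚᵘ.≃-trans (ℚ.toℚᵘ-homo-+ 1ℚ (ℚ.- ((+ a) ℚ./ D))) (ℚᵘ.+-congʳ ℚᵘ.1ℚᵘ
      (ℚᵘ.≃-trans (ℚ.toℚᵘ-homo‿- ((+ a) ℚ./ D)) (ℚᵘ.-‿cong (ℚ.toℚᵘ-fromℚᵘ ((+ a) ℚᵘ./ D))))))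
    (ℚ.toℚᵘ-fromℚᵘ ((+ n) ℚᵘ./ 1)))
  expand : ∀ a D n → ((+ 1 ℤ.* D ℤ.+ ℤ.- a ℤ.* + 1) ℤ.* n) ℤ.* + 1 ≡ n ℤ.* D ℤ.- a ℤ.* n
  expand = ℤ-Solver.solve-∀
  collect : ∀ t D n → n ℤ.* D ℤ.- t ℤ.* D ≡ (n ℤ.- t) ℤ.* D
  collect = ℤ-Solver.solve-∀
  +n-t : + n ℤ.- + t ≡ + (n ∸ t)
  +n-t = trans (ℤ.m-n≡m⊖n n t) (ℤ.⊖-≥ t≤n)
  xᵘ≤n∸t : xᵘ ℚᵘ.≤ ℚᵘ.mkℚᵘ (+ (n ∸ t)) 0
  xᵘ≤n∸t = ℚᵘ.*≤* (begin
    ℚᵘ.↥ xᵘ ℤ.* + 1                       ≡⟨ expand (+ a) (+ D) (+ n) ⟩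
    + n ℤ.* + D ℤ.- + a ℤ.* + n           ≤⟨ ℤ.+-monoʳ-≤ (+ n ℤ.* + D) (ℤ.neg-mono-≤
                                               (subst₂ ℤ._≤_ (ℤ.pos-* t D) (ℤ.pos-* a n) (ℤ.+≤+ tD≤an))) ⟩
    + n ℤ.* + D ℤ.- + t ℤ.* + D           ≡⟨ collect (+ t) (+ D) (+ n) ⟩
    (+ n ℤ.- + t) ℤ.* + D                 ≡⟨ cong₂ ℤ._*_ +n-t (cong +_ (sym
                                               (trans (ℕ.*-identityʳ (1 * D)) (ℕ.*-identityˡ D)))) ⟩
    + (n ∸ t) ℤ.* ℚᵘ.↧ xᵘ                 ∎)
  x≤n∸t : ℚ.toℚᵘ x ℚᵘ.≤ ℚᵘ.mkℚᵘ (+ (n ∸ t)) 0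
  x≤n∸t = ℚᵘ.≤-trans (ℚᵘ.≤-reflexive x≃xᵘ) xᵘ≤n∸t

-- α is a variable here, since unfolding the minimum α* H is expensive.
module _ {h} .{{_ : NonZero h}} (H : OrderedGraph h) (α : ℚ.ℚ)
         (q : ℕ) .{{_ : NonZero q}} (ℓ : ℕ) .{{_ : NonZero ℓ}} where
  private instance
    _ = ℕ.m*n≢0 ℓ h

  HasObstruction : Set₁
  HasObstruction = Σ[ G ∈ OrderedGraph (q * h) ]
    (floor ((1ℚ ℚ.- α) ℚ.* ((+ (q * h)) ℚ./ 1)) ℤ.- (+ 1) ℤ.≤ + δ G)
    × ¬ HasPerfectTiling H G

  δ-bound : ∀ {a} {G : OrderedGraph (q * h)} → α ≡ (+ a) ℚ./ (ℓ * h) → a ≤ h →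
    CoDegreeBounded G (blockLength a q ℓ) →
    floor ((1ℚ ℚ.- α) ℚ.* ((+ (q * h)) ℚ./ 1)) ℤ.- (+ 1) ℤ.≤ + δ G
  δ-bound {a} refl a≤h b = ℤ.≤-trans (degree-bound a h q ℓ a≤h) (ℤ.+≤+ (n∸s≤δ b))

  obstruction⁺ : ℓ < χ< H → α ≡ (+ α⁺ H ℓ) ℚ./ (ℓ * h) → HasObstruction
  obstruction⁺ ℓ<χ α≡ =
    let fℓ<h = greedy-unexhausted H (α⁺-greedy H) id ℓ<χ
        (G , b , noTiling) = greedy-obstruction {q = q} (α⁺-greedy H) ℓ fℓ<h
    in G , δ-bound α≡ (ℕ.<⇒≤ fℓ<h) b , noTiling

  -- The greedy sequence lives on `reverse H`; reversing the graph built from it gives an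
  -- obstruction for `H` with the same degree bound.
  obstruction⁻ : ℓ < χ< H → α ≡ (+ (suc h ∸ α⁻ H ℓ)) ℚ./ (ℓ * h) → HasObstruction
  obstruction⁻ ℓ<χ α≡ =
    let fℓ<h = greedy-unexhausted H (α⁻-greedy H) (reverse-intervalPartitionable H) ℓ<χ
        (G , b , noTiling) = greedy-obstruction {q = q} (α⁻-greedy H) ℓ fℓ<h
    in reverse G , δ-bound α≡ (ℕ.<⇒≤ fℓ<h) (reverse-coDegreeBounded b) ,
       noTiling ∘ reverse-hasPerfectTiling

  obstruction : ℓ < χ< H → α ≡ α*-term H ℓ → HasObstruction
  obstruction ℓ<χ α≡ with ℚ.⊓-sel ((+ α⁺ H ℓ) ℚ./ (ℓ * h)) ((+ (suc h ∸ α⁻ H ℓ)) ℚ./ (ℓ * h))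
  ... | inj₁ eq = obstruction⁺ ℓ<χ (trans α≡ eq)
  ... | inj₂ eq = obstruction⁻ ℓ<χ (trans α≡ eq)

proposition1p5 :
    (h : ℕ) .{{_ : NonZero h}} (H : OrderedGraph h) → 2 ≤ χ< H →
    (n : ℕ) .{{_ : NonZero n}} → h ∣ n →
    Σ[ G ∈ OrderedGraph n ]
      (floor ((1ℚ ℚ.- α* H) ℚ.* ((+ n) ℚ./ 1)) ℤ.- (+ 1) ℤ.≤ + δ G)
      × ¬ HasPerfectTiling H G
proposition1p5 h H 2≤χ n (divides-refl q) =
  let (i , ℓ<χ , α*≡) = α*-attained H 2≤χ
  -- The quotient `q` is nonzero because `n = q * h` is.
  in obstruction H (α* H) q {{ℕ.m*n≢0⇒m≢0 q {h}}} (suc i) ℓ<χ α*≡
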